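{- Let $m\ge 7$ be an integer. Then for every integer $n\ge m-1$, $$F_{n+2^{m-6},2}\equiv F_{n,2}\pmod{2^m},$$ i.e. from the term of index $m-1$ onward the sequence $(F_{n,2}\bmod 2^m)_{n\ge0}$ is periodic with period $2^{m-6}$.
   Context: For positive integers $r\le m\le n$, $S_r(n,m)$ denotes the $r$-Stirling number of the second kind: the number of partitions of $\{1,\dots,n\}$ into $m$ non-empty blocks such that $1,\dots,r$ lie in pairwise distinct blocks. For a positive integer $r$ and integer $n\ge 0$, the $r$-Fubini number is $F_{n,r}=\sum_{k=0}^{n}(k+r)!\,S_r(n+r,k+r)$. -}

module Defs where

open import Data.Nat using (ℕ; zero; suc; _+_; _*_; _<_; _≟_; _<?_; _!)
open import Data.Fin using (Fin; toℕ)
import Data.Fin.Properties as Fin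
open import Data.Fin.Subset using (Subset; inside; outside; _∈_; _∩_; Nonempty; Empty)
open import Data.Fin.Subset.Properties using (_∈?_; nonempty?)
open import Data.List using (List; []; _∷_; [_]; _++_; map; filter; length; upTo)
open import Data.Nat.ListAction using (sum)
open import Data.List.Relation.Unary.All using (All; all?)
open import Data.List.Relation.Unary.Any using (Any; any?)
open import Data.List.Relation.Unary.AllPairs using (AllPairs; allPairs?)
open import Data.Product using (_×_)
import Data.Vec as Vec
open import Relation.Binary.PropositionalEquality using (_≡_)
open import Relation.Nullary using (Dec; ¬?)
open import Relation.Nullary.Decidable using (_×-dec_; _→-dec_)

subsets : ∀ n → List (Subset n)
subsets zero    = [ Vec.[] ]
subsets (suc n) = map (outside Vec.∷_) (subsets n) ++ map (inside Vec.∷_) (subsets n)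

sublists : ∀ {A : Set} → List A → List (List A)
sublists []       = [ [] ]
sublists (x ∷ xs) = sublists xs ++ map (x ∷_) (sublists xs)

-- A set of subsets of Fin n is a list of subsets occurring in the order of
-- `subsets n`.  As `subsets n` has no repetitions, each such set is listed
-- exactly once.
families : ∀ n → List (List (Subset n))
families n = sublists (subsets n)

IsPartition : ∀ {n} → List (Subset n) → Set
IsPartition P =
  All Nonempty P ×
  AllPairs (λ B C → Empty (B ∩ C)) P ×
  (∀ i → Any (i ∈_) P)

-- The ground set {1,…,n} is Fin n with i standing for toℕ i + 1, so the
-- elements 1,…,r are those with toℕ i < r.
Separates : ∀ {n} → ℕ → List (Subset n) → Set
Separates r P =
  All (λ B → ∀ i j → toℕ i < r → toℕ j < r → i ∈ B → j ∈ B → i ≡ j) P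

IsStirlingPartition : ∀ {n} → ℕ → ℕ → List (Subset n) → Set
IsStirlingPartition r m P = IsPartition P × length P ≡ m × Separates r P

isPartition? : ∀ {n} (P : List (Subset n)) → Dec (IsPartition P)
isPartition? P =
  all? nonempty? P ×-dec
  allPairs? (λ B C → ¬? (nonempty? (B ∩ C))) P ×-dec
  Fin.all? (λ i → any? (i ∈?_) P)

separates? : ∀ {n} r (P : List (Subset n)) → Dec (Separates r P)
separates? r = all? λ B → Fin.all? λ i → Fin.all? λ j →
  (toℕ i <? r) →-dec ((toℕ j <? r) →-dec
  ((i ∈? B) →-dec ((j ∈? B) →-dec (i Fin.≟ j))))

isStirlingPartition? : ∀ {n} r m (P : List (Subset n)) → Dec (IsStirlingPartition r m P)
isStirlingPartition? r m P =
  isPartition? P ×-dec (length P ≟ m) ×-dec separates? r P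

-- S r n m is S_r(n,m).
S : ℕ → ℕ → ℕ → ℕ
S r n m = length (filter (isStirlingPartition? r m) (families n))

-- F n r is F_{n,r}; `upTo (suc n)` is 0,…,n.
F : ℕ → ℕ → ℕ
F n r = sum (map (λ k → (k + r) ! * S r (n + r) (k + r)) (upTo (suc n)))

{-# OPTIONS --safe #-}
module Submission where

-- Let T(n,k) = (k+2)! S₂(n+2,k+2), so that F_{n,2} = ∑ₖ T(n,k).  The Stirling
-- recurrence gives T(n+1,k) = (k+2)(T(n,k) + T(n,k-1)), hence
-- ∑ₖ T(n+1,k) a(k) = ∑ₖ T(n,k) ((k+2) a(k) + (k+3) a(k+1)).  For each i ≥ 1 the
-- sequence eᵢ(k) = (-1)ᵏ (k+i+1 choose k+2) is an eigenvector of the operator on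
-- the right, with eigenvalue -i, and 2-adically ∑ᵢ 2ⁱ⁻¹ eᵢ(k) = -1.  Therefore,
-- 2-adically,
--
--   F_{n,2} = - ∑_{i ≥ 1} 2ⁱ⁻¹ (-i)ⁿ i (i+1).
--
-- Modulo 2ᵐ the terms with i even vanish once n+1 ≥ m.  The term i = 1 depends
-- only on the parity of n.  For odd i ≥ 3 the number 2ⁱ⁻¹(i+1) is divisible by 16,
-- and iⁿ has period 2ᵐ⁻⁶ modulo 2ᵐ⁻⁴.

open import Defs
open import Data.Fin using (Fin; zero; suc; toℕ)
open import Data.Fin.Properties using (toℕ-injective)
open import Data.Fin.Subset using (Subset; inside; outside; _∈_; _∩_; Nonempty; Empty)
open import Data.Fin.Subset.Properties using (_∈?_; nonempty?; ∩-comm; x∈p∩q⁺; x∈p∩q⁻)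
open import Data.List using (List; []; _∷_; [_]; _++_; map; filter; length; upTo)
open import Data.List.Properties using (map-++; map-∘; map-cong; length-map; upTo-∷ʳ)
open import Data.List.Relation.Binary.Permutation.Propositional using (_↭_; prep; swap; ↭-refl; ↭-sym; ↭-trans; ↭⇒↭ₛ)
open import Data.List.Relation.Binary.Permutation.Propositional.Properties using (All-resp-↭; Any-resp-↭; ↭-length; ++-comm)
open import Data.List.Relation.Binary.Permutation.Setoid.Properties using (AllPairs-resp-↭)
open import Data.List.Relation.Unary.All using (All; []; _∷_)
import Data.List.Relation.Unary.All as All
import Data.List.Relation.Unary.All.Properties as All
open import Data.List.Relation.Unary.AllPairs using (AllPairs; []; _∷_)
import Data.List.Relation.Unary.AllPairs as AllPairs
import Data.List.Relation.Unary.AllPairs.Properties as AllPairs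
open import Data.List.Relation.Unary.Any using (Any; here; there)
import Data.List.Relation.Unary.Any as Any
import Data.List.Relation.Unary.Any.Properties as Any
open import Data.Bool using (if_then_else_)
open import Data.Nat as ℕ using (ℕ; zero; suc; _∸_; _≤_; _<_; z≤n; s≤s; z<s; s<s; _!)
open import Data.Nat.ListAction using (sum)
open import Data.Nat.ListAction.Properties using (sum-++)
import Data.Nat.Properties as ℕ
import Data.Nat.Tactic.RingSolver as ℕ-Solver
open import Data.Product using (∃; _×_; _,_; proj₁; proj₂)
open import Data.Sum using (_⊎_; inj₁; inj₂)
open import Data.Vec using (here; there)
import Data.Vec as Vec
open import Function using (_∘_)
open import Function.Bundles using (_⇔_; mk⇔; Equivalence)
open import Relation.Binary.PropositionalEquality using (_≡_; refl; sym; trans; cong; cong₂; subst; resp₂; setoid; module ≡-Reasoning)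
open import Relation.Nullary using (Dec; yes; no; does; ¬_; ¬?; contradiction)
open import Relation.Nullary.Decidable using (does-⇔; _×-dec_; dec-false; dec-true)

open ≡-Reasoning

module Counting where

  open import Data.Nat using (_+_; _*_)
  open import Data.Nat.Properties using (+-comm; +-identityʳ; *-zeroʳ; *-identityˡ; *-distribˡ-+; *-distribʳ-+; suc-injective; ≤-trans; ≤-pred; n<1⇒n≡0; m<n⇒m<1+n)
  open import Data.Nat.Tactic.RingSolver using (solve-∀)
  open Equivalence using (to; from)

  private variable
    A B X Y : Set

  ∑ : List A → (A → ℕ) → ℕ
  ∑ xs f = sum (map f xs)

  ∑-cong : ∀ (xs : List A) {f g : A → ℕ} → (∀ x → f x ≡ g x) → ∑ xs f ≡ ∑ xs g
  ∑-cong xs f≗g = cong sum (map-cong f≗g xs)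

  ∑-zero : ∀ (xs : List A) {f : A → ℕ} → (∀ x → f x ≡ 0) → ∑ xs f ≡ 0
  ∑-zero []       f≗0 = refl
  ∑-zero (x ∷ xs) f≗0 = cong₂ _+_ (f≗0 x) (∑-zero xs f≗0)

  ∑-++ : ∀ (xs ys : List A) f → ∑ (xs ++ ys) f ≡ ∑ xs f + ∑ ys f
  ∑-++ xs ys f = trans (cong sum (map-++ f xs ys)) (sum-++ (map f xs) (map f ys))

  ∑-map : ∀ (g : A → B) xs f → ∑ (map g xs) f ≡ ∑ xs (f ∘ g)
  ∑-map g xs f = cong sum (sym (map-∘ xs))

  ∑-+ : ∀ (xs : List A) f g → ∑ xs (λ x → f x + g x) ≡ ∑ xs f + ∑ xs g
  ∑-+ []       f g = refl
  ∑-+ (x ∷ xs) f g = trans (cong (f x + g x +_) (∑-+ xs f g)) (interchange (f x) (g x) _ _)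
    where
    interchange : ∀ a b c d → (a + b) + (c + d) ≡ (a + c) + (b + d)
    interchange = solve-∀

  ∑-*ˡ : ∀ c (xs : List A) f → ∑ xs (λ x → c * f x) ≡ c * ∑ xs f
  ∑-*ˡ c []       f = sym (*-zeroʳ c)
  ∑-*ˡ c (x ∷ xs) f = trans (cong (c * f x +_) (∑-*ˡ c xs f)) (sym (*-distribˡ-+ c (f x) _))

  ∑-*ʳ : ∀ c (xs : List A) f → ∑ xs (λ x → f x * c) ≡ ∑ xs f * c
  ∑-*ʳ c []       f = refl
  ∑-*ʳ c (x ∷ xs) f = trans (cong (f x * c +_) (∑-*ʳ c xs f)) (sym (*-distribʳ-+ c (f x) _))

  𝟙 : Dec X → ℕ
  𝟙 d = if does d then 1 else 0

  𝟙-cong : X ⇔ Y → (x? : Dec X) (y? : Dec Y) → 𝟙 x? ≡ 𝟙 y?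
  𝟙-cong X⇔Y x? y? = cong (if_then 1 else 0) (does-⇔ X⇔Y x? y?)

  𝟙-false : (x? : Dec X) → ¬ X → 𝟙 x? ≡ 0
  𝟙-false x? ¬x = cong (if_then 1 else 0) (dec-false x? ¬x)

  𝟙-true : (x? : Dec X) → X → 𝟙 x? ≡ 1
  𝟙-true x? x = cong (if_then 1 else 0) (dec-true x? x)

  𝟙-× : (x? : Dec X) (y? : Dec Y) → 𝟙 (x? ×-dec y?) ≡ 𝟙 x? * 𝟙 y?
  𝟙-× (yes _) y? = sym (+-identityʳ _)
  𝟙-× (no _)  y? = refl

  *-𝟙-cong : ∀ {a b} (x? : Dec X) → (X → a ≡ b) → a * 𝟙 x? ≡ b * 𝟙 x?
  *-𝟙-cong         (yes x) a≡b = cong (_* 1) (a≡b x)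
  *-𝟙-cong {a = a} {b} (no _) _ = trans (*-zeroʳ a) (sym (*-zeroʳ b))

  length-filter≡∑ : ∀ {P : A → Set} (P? : ∀ x → Dec (P x)) xs →
                    length (filter P? xs) ≡ ∑ xs (𝟙 ∘ P?)
  length-filter≡∑ P? []       = refl
  length-filter≡∑ P? (x ∷ xs) with P? x
  ... | yes _ = cong suc (length-filter≡∑ P? xs)
  ... | no _  = length-filter≡∑ P? xs

  -- Sums over sublists

  ∑-sublists-∷ : ∀ (x : A) xs w →
    ∑ (sublists (x ∷ xs)) w ≡ ∑ (sublists xs) w + ∑ (sublists xs) (w ∘ (x ∷_))
  ∑-sublists-∷ x xs w =
    trans (∑-++ (sublists xs) _ w) (cong (∑ (sublists xs) w +_) (∑-map (x ∷_) (sublists xs) w))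

  ∑-sublists-map : ∀ (f : A → B) xs w →
    ∑ (sublists (map f xs)) w ≡ ∑ (sublists xs) (w ∘ map f)
  ∑-sublists-map f []       w = refl
  ∑-sublists-map f (x ∷ xs) w = begin
    ∑ (sublists (f x ∷ map f xs)) w
      ≡⟨ ∑-sublists-∷ (f x) (map f xs) w ⟩
    ∑ (sublists (map f xs)) w + ∑ (sublists (map f xs)) (w ∘ (f x ∷_))
      ≡⟨ cong₂ _+_ (∑-sublists-map f xs w) (∑-sublists-map f xs _) ⟩
    ∑ (sublists xs) (w ∘ map f) + ∑ (sublists xs) (w ∘ map f ∘ (x ∷_))
      ≡⟨ ∑-sublists-∷ x xs (w ∘ map f) ⟨
    ∑ (sublists (x ∷ xs)) (w ∘ map f) ∎

  ∑-sublists-++ : ∀ (xs ys : List A) w →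
    ∑ (sublists (xs ++ ys)) w ≡ ∑ (sublists ys) λ Q → ∑ (sublists xs) λ P → w (P ++ Q)
  ∑-sublists-++ []       ys w = ∑-cong (sublists ys) λ Q → sym (+-identityʳ (w Q))
  ∑-sublists-++ (x ∷ xs) ys w = begin
    ∑ (sublists (x ∷ xs ++ ys)) w
      ≡⟨ ∑-sublists-∷ x (xs ++ ys) w ⟩
    ∑ (sublists (xs ++ ys)) w + ∑ (sublists (xs ++ ys)) (w ∘ (x ∷_))
      ≡⟨ cong₂ _+_ (∑-sublists-++ xs ys w) (∑-sublists-++ xs ys (w ∘ (x ∷_))) ⟩
    _ ≡⟨ ∑-+ (sublists ys) _ _ ⟨
    ∑ (sublists ys) (λ Q → ∑ (sublists xs) (λ P → w (P ++ Q)) + ∑ (sublists xs) (λ P → w (x ∷ P ++ Q)))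
      ≡⟨ ∑-cong (sublists ys) (λ Q → ∑-sublists-∷ x xs (λ P → w (P ++ Q))) ⟨
    ∑ (sublists ys) (λ Q → ∑ (sublists (x ∷ xs)) λ P → w (P ++ Q)) ∎

  ∑-sublists-[] : ∀ (xs : List A) w → (∀ x P → w (x ∷ P) ≡ 0) → ∑ (sublists xs) w ≡ w []
  ∑-sublists-[] []       w w-∷ = +-identityʳ _
  ∑-sublists-[] (x ∷ xs) w w-∷ = begin
    ∑ (sublists (x ∷ xs)) w
      ≡⟨ ∑-sublists-∷ x xs w ⟩
    ∑ (sublists xs) w + ∑ (sublists xs) (w ∘ (x ∷_))
      ≡⟨ cong₂ _+_ (∑-sublists-[] xs w w-∷) (∑-zero (sublists xs) (w-∷ x)) ⟩
    w [] + 0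
      ≡⟨ +-identityʳ _ ⟩
    w [] ∎

  ∑-sublists-singletons : ∀ (xs : List A) w → w [] ≡ 0 → (∀ x y P → w (x ∷ y ∷ P) ≡ 0) →
    ∑ (sublists xs) w ≡ ∑ xs (w ∘ [_])
  ∑-sublists-singletons []       w w-[] w-∷∷ = trans (+-identityʳ _) w-[]
  ∑-sublists-singletons (x ∷ xs) w w-[] w-∷∷ = begin
    ∑ (sublists (x ∷ xs)) w
      ≡⟨ ∑-sublists-∷ x xs w ⟩
    ∑ (sublists xs) w + ∑ (sublists xs) (w ∘ (x ∷_))
      ≡⟨ cong₂ _+_ (∑-sublists-singletons xs w w-[] w-∷∷) (∑-sublists-[] xs (w ∘ (x ∷_)) (w-∷∷ x)) ⟩
    ∑ xs (w ∘ [_]) + w [ x ]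
      ≡⟨ +-comm _ (w [ x ]) ⟩
    ∑ (x ∷ xs) (w ∘ [_]) ∎

  -- Double counting of the pairs (P, x) with x a marked member of P.
  ∑-marked : ∀ (q : A → ℕ) xs (w : List A → ℕ) →
    (∀ {P Q} → P ↭ Q → w P ≡ w Q) → (∀ x P → w (x ∷ x ∷ P) ≡ 0) →
    ∑ xs (λ x → q x * ∑ (sublists xs) λ P → w (x ∷ P)) ≡ ∑ (sublists xs) λ P → ∑ P q * w P
  ∑-marked q []       w w-↭ w-dup = refl
  ∑-marked q (x ∷ xs) w w-↭ w-dup = begin
    q x * ∑ (sublists (x ∷ xs)) (w ∘ (x ∷_)) + ∑ xs (λ y → q y * ∑ (sublists (x ∷ xs)) (w ∘ (y ∷_)))
      ≡⟨ cong₂ (λ a b → q x * a + b) head tail ⟩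
    q x * s + (t + u)
      ≡⟨ rearrange (q x * s) t u ⟩
    t + (q x * s + u)
      ≡⟨ cong (λ a → t + (a + u)) (∑-*ˡ (q x) (sublists xs) (w ∘ (x ∷_))) ⟨
    t + (∑ (sublists xs) (λ P → q x * w (x ∷ P)) + u)
      ≡⟨ cong (t +_) (∑-+ (sublists xs) _ _) ⟨
    t + ∑ (sublists xs) (λ P → q x * w (x ∷ P) + ∑ P q * w (x ∷ P))
      ≡⟨ cong (t +_) (∑-cong (sublists xs) (λ P → *-distribʳ-+ (w (x ∷ P)) (q x) (∑ P q))) ⟨
    t + ∑ (sublists xs) (λ P → ∑ (x ∷ P) q * w (x ∷ P))
      ≡⟨ ∑-sublists-∷ x xs (λ P → ∑ P q * w P) ⟨
    ∑ (sublists (x ∷ xs)) (λ P → ∑ P q * w P) ∎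
    where
    s = ∑ (sublists xs) (w ∘ (x ∷_))
    t = ∑ (sublists xs) λ P → ∑ P q * w P
    u = ∑ (sublists xs) λ P → ∑ P q * w (x ∷ P)

    rearrange : ∀ a b c → a + (b + c) ≡ b + (a + c)
    rearrange = solve-∀

    head : ∑ (sublists (x ∷ xs)) (w ∘ (x ∷_)) ≡ s
    head = begin
      ∑ (sublists (x ∷ xs)) (w ∘ (x ∷_))
        ≡⟨ ∑-sublists-∷ x xs _ ⟩
      s + ∑ (sublists xs) (λ P → w (x ∷ x ∷ P))
        ≡⟨ cong (s +_) (∑-zero (sublists xs) (w-dup x)) ⟩
      s + 0
        ≡⟨ +-identityʳ s ⟩
      s ∎

    tail : ∑ xs (λ y → q y * ∑ (sublists (x ∷ xs)) (w ∘ (y ∷_))) ≡ t + u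
    tail = begin
      ∑ xs (λ y → q y * ∑ (sublists (x ∷ xs)) (w ∘ (y ∷_)))
        ≡⟨ ∑-cong xs (λ y → begin
            q y * ∑ (sublists (x ∷ xs)) (w ∘ (y ∷_))
              ≡⟨ cong (q y *_) (∑-sublists-∷ x xs _) ⟩
            q y * (∑ (sublists xs) (w ∘ (y ∷_)) + ∑ (sublists xs) (λ P → w (y ∷ x ∷ P)))
              ≡⟨ *-distribˡ-+ (q y) _ _ ⟩
            q y * ∑ (sublists xs) (w ∘ (y ∷_)) + q y * ∑ (sublists xs) (λ P → w (y ∷ x ∷ P))
              ≡⟨ cong (λ a → _ + q y * a) (∑-cong (sublists xs) λ P → w-↭ (swap y x ↭-refl)) ⟩
            q y * ∑ (sublists xs) (w ∘ (y ∷_)) + q y * ∑ (sublists xs) (λ P → w (x ∷ y ∷ P)) ∎) ⟩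
      _ ≡⟨ ∑-+ xs _ _ ⟩
      _ ≡⟨ cong₂ _+_ (∑-marked q xs w w-↭ w-dup)
                     (∑-marked q xs (w ∘ (x ∷_)) (w-↭ ∘ prep x)
                       λ y P → trans (w-↭ (↭-trans (swap x y ↭-refl) (prep y (swap x y ↭-refl)))) (w-dup y (x ∷ P))) ⟩
      t + u ∎

  -- Set partitions

  Disjoint : ∀ {n} → Subset n → Subset n → Set
  Disjoint B C = Empty (B ∩ C)

  Empty-out : ∀ {n} {B : Subset n} → Empty (outside Vec.∷ B) ⇔ Empty B
  Empty-out = mk⇔ (λ e (i , i∈B) → e (suc i , there i∈B)) (λ { e (suc i , there i∈B) → e (i , i∈B) })

  Nonempty-out : ∀ {n} {B : Subset n} → Nonempty (outside Vec.∷ B) ⇔ Nonempty B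
  Nonempty-out = mk⇔ (λ { (suc i , there i∈B) → i , i∈B }) (λ { (i , i∈B) → suc i , there i∈B })

  ∑-empty : ∀ n → ∑ (subsets n) (λ B → 𝟙 (¬? (nonempty? B))) ≡ 1
  ∑-empty zero    = refl
  ∑-empty (suc n) = begin
    ∑ (subsets (suc n)) (λ B → 𝟙 (¬? (nonempty? B)))
      ≡⟨ ∑-++ (map (outside Vec.∷_) (subsets n)) _ _ ⟩
    _ ≡⟨ cong₂ _+_ (∑-map (outside Vec.∷_) (subsets n) _) (∑-map (inside Vec.∷_) (subsets n) _) ⟩
    ∑ (subsets n) (λ B → 𝟙 (¬? (nonempty? (outside Vec.∷ B)))) + ∑ (subsets n) (λ B → 𝟙 (¬? (nonempty? (inside Vec.∷ B))))
      ≡⟨ cong₂ _+_ (trans (∑-cong (subsets n) λ B → 𝟙-cong Empty-out (¬? (nonempty? _)) (¬? (nonempty? B))) (∑-empty n))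
                   (∑-zero (subsets n) λ B → 𝟙-false (¬? (nonempty? (inside Vec.∷ B))) λ e → e (zero , here)) ⟩
    1 ∎

  isStirlingPartition-↭ : ∀ {n} r m {P Q : List (Subset n)} → P ↭ Q →
    IsStirlingPartition r m P → IsStirlingPartition r m Q
  isStirlingPartition-↭ r m P↭Q ((ne , disj , cover) , len , sep) =
    (All-resp-↭ P↭Q ne
    , AllPairs-resp-↭ (setoid _) (λ {B} {C} → subst Empty (∩-comm B C)) (resp₂ Disjoint) (↭⇒↭ₛ P↭Q) disj
    , λ i → Any-resp-↭ P↭Q (cover i))
    , trans (sym (↭-length P↭Q)) len
    , All-resp-↭ P↭Q sep

  𝟙-stirling-↭ : ∀ {n} r m {P Q : List (Subset n)} → P ↭ Q →
    𝟙 (isStirlingPartition? r m P) ≡ 𝟙 (isStirlingPartition? r m Q)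
  𝟙-stirling-↭ r m P↭Q =
    𝟙-cong (mk⇔ (isStirlingPartition-↭ r m P↭Q) (isStirlingPartition-↭ r m (↭-sym P↭Q))) (isStirlingPartition? r m _) (isStirlingPartition? r m _)

  𝟙-stirling-duplicate : ∀ {n} r m (B : Subset n) P → 𝟙 (isStirlingPartition? r m (B ∷ B ∷ P)) ≡ 0
  𝟙-stirling-duplicate r m B P = 𝟙-false (isStirlingPartition? r m (B ∷ B ∷ P))
    λ { (((i , i∈B) ∷ _ , (B∩B=∅ ∷ _) ∷ _ , _) , _) → B∩B=∅ (i , x∈p∩q⁺ (i∈B , i∈B)) }

  separates-0 : ∀ {n} (P : List (Subset n)) → Separates 0 P
  separates-0 P = All.universal (λ _ _ _ ()) P

  separates-out : ∀ {n r} → r ≤ 2 → (P : List (Subset n)) → Separates r (map (outside Vec.∷_) P)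
  separates-out {n} {r} r≤2 P = All.map⁺ (All.universal separated P)
    where
    zero! : {i : Fin n} → suc (toℕ i) < r → toℕ i ≡ 0
    zero! i<r = n<1⇒n≡0 (≤-pred (≤-trans i<r r≤2))
    separated : ∀ B i j → toℕ i < r → toℕ j < r → i ∈ outside Vec.∷ B → j ∈ outside Vec.∷ B → i ≡ j
    separated B (suc i) (suc j) i<r j<r _ _ = cong suc (toℕ-injective (trans (zero! {i} i<r) (sym (zero! {j} j<r))))

  separates-singleton : ∀ {n} r (B : Subset n) → Empty B → Separates r [ inside Vec.∷ B ]
  separates-singleton r B B=∅ = separated ∷ []
    where
    separated : ∀ i j → toℕ i < r → toℕ j < r → i ∈ inside Vec.∷ B → j ∈ inside Vec.∷ B → i ≡ j
    separated zero    zero    _ _ _ _           = refl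
    separated zero    (suc j) _ _ _ (there j∈B) = contradiction (j , j∈B) B=∅
    separated (suc i) _       _ _ (there i∈B) _ = contradiction (i , i∈B) B=∅

  adjoin : ∀ {n} → Subset n → List (Subset n) → List (Subset (suc n))
  adjoin B P = (inside Vec.∷ B) ∷ map (outside Vec.∷_) P

  Disjoint-out⁻ : ∀ {n} {P : List (Subset n)} {b B} →
    All (Disjoint (b Vec.∷ B)) (map (outside Vec.∷_) P) → All (Disjoint B) P
  Disjoint-out⁻ ds = All.map (λ { d (i , i∈) → d (suc i , there i∈) }) (All.map⁻ ds)

  Disjoint-out⁺ : ∀ {n} {P : List (Subset n)} {b B} →
    All (Disjoint B) P → All (Disjoint (b Vec.∷ B)) (map (outside Vec.∷_) P)
  Disjoint-out⁺ {b = inside}  ds = All.map⁺ (All.map (from Empty-out) ds)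
  Disjoint-out⁺ {b = outside} ds = All.map⁺ (All.map (from Empty-out) ds)

  module _ {n r : ℕ} (r≤2 : r ≤ 2) (m : ℕ) (B : Subset n) (P : List (Subset n)) where

    cover⁻ : (∀ i → Any (i ∈_) (adjoin B P)) → ∀ i → Any (i ∈_) (B ∷ P)
    cover⁻ cover i with cover (suc i)
    ... | here (there i∈B) = here i∈B
    ... | there i∈P        = there (Any.map (λ { (there i∈C) → i∈C }) (Any.map⁻ i∈P))

    cover⁺ : (∀ i → Any (i ∈_) (B ∷ P)) → ∀ i → Any (i ∈_) (adjoin B P)
    cover⁺ cover zero = here here
    cover⁺ cover (suc i) with cover i
    ... | here i∈B  = here (there i∈B)
    ... | there i∈P = there (Any.map⁺ (Any.map there i∈P))

    adjoin-to-block :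
      Nonempty B → IsStirlingPartition r (suc m) (adjoin B P) ⇔
      (Separates r [ inside Vec.∷ B ] × IsStirlingPartition 0 (suc m) (B ∷ P))
    adjoin-to-block B≠∅ = mk⇔
      (λ { ((_ ∷ ne , d ∷ ds , cover) , len , s ∷ _) →
        s ∷ [] ,
        (B≠∅ ∷ All.map (to Nonempty-out) (All.map⁻ ne)
        , Disjoint-out⁻ d ∷ AllPairs.map (to Empty-out) (AllPairs.map⁻ ds)
        , cover⁻ cover)
        , trans (cong suc (sym (length-map _ P))) len
        , separates-0 (B ∷ P) })
      (λ { (s ∷ [] , (_ ∷ ne , d ∷ ds , cover) , len , _) →
        ((zero , here) ∷ All.map⁺ (All.map (from Nonempty-out) ne)
        , Disjoint-out⁺ d ∷ AllPairs.map⁺ (AllPairs.map (from Empty-out) ds)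
        , cover⁺ cover)
        , trans (cong suc (length-map _ P)) len
        , s ∷ separates-out r≤2 P })

    adjoin-singleton :
      Empty B → IsStirlingPartition r (suc m) (adjoin B P) ⇔ IsStirlingPartition 0 m P
    adjoin-singleton B=∅ = mk⇔
      (λ { ((_ ∷ ne , d ∷ ds , cover) , len , s ∷ _) →
        (All.map (to Nonempty-out) (All.map⁻ ne)
        , AllPairs.map (to Empty-out) (AllPairs.map⁻ ds)
        , λ i → Any.tail (λ i∈B → B=∅ (i , i∈B)) (cover⁻ cover i))
        , trans (sym (length-map _ P)) (suc-injective len)
        , separates-0 P })
      (λ { ((ne , ds , cover) , len , _) →
        ((zero , here) ∷ All.map⁺ (All.map (from Nonempty-out) ne)
        , Disjoint-out⁺ (All.universal (λ { C (i , i∈) → B=∅ (i , proj₁ (x∈p∩q⁻ B C i∈)) }) P)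
          ∷ AllPairs.map⁺ (AllPairs.map (from Empty-out) ds)
        , cover⁺ (there ∘ cover))
        , cong suc (trans (length-map _ P) len)
        , All.head (separates-singleton r B B=∅) ∷ separates-out r≤2 P })

    𝟙-adjoin :
      𝟙 (isStirlingPartition? r (suc m) (adjoin B P)) ≡
      𝟙 (¬? (nonempty? B)) * 𝟙 (isStirlingPartition? 0 m P) +
      𝟙 (separates? r [ inside Vec.∷ B ]) * 𝟙 (isStirlingPartition? 0 (suc m) (B ∷ P))
    𝟙-adjoin = split (nonempty? B)
      where
      adj? = isStirlingPartition? r (suc m) (adjoin B P)
      sep? = separates? r [ inside Vec.∷ B ]
      P?   = isStirlingPartition? 0 m P
      B∷P? = isStirlingPartition? 0 (suc m) (B ∷ P)

      padding : ∀ a b → a ≡ 1 * a + b * 0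
      padding = solve-∀

      split : (B? : Dec (Nonempty B)) → 𝟙 adj? ≡ 𝟙 (¬? B?) * 𝟙 P? + 𝟙 sep? * 𝟙 B∷P?
      split (yes B≠∅) = trans (𝟙-cong (adjoin-to-block B≠∅) adj? (sep? ×-dec B∷P?)) (𝟙-× sep? B∷P?)
      split (no B=∅)  = begin
        𝟙 adj?                       ≡⟨ 𝟙-cong (adjoin-singleton B=∅) adj? P? ⟩
        𝟙 P?                         ≡⟨ padding (𝟙 P?) (𝟙 sep?) ⟩
        1 * 𝟙 P? + 𝟙 sep? * 0        ≡⟨ cong (λ z → 1 * 𝟙 P? + 𝟙 sep? * z) (𝟙-false B∷P? λ { ((B≠∅ ∷ _ , _) , _) → B=∅ B≠∅ }) ⟨
        1 * 𝟙 P? + 𝟙 sep? * 𝟙 B∷P?   ∎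

  -- The block containing the new element 0, with 0 deleted, is either empty or a
  -- block of the remaining partition that may receive 0.
  S-suc : ∀ {r} → r ≤ 2 → ∀ n m → S r (suc n) (suc m) ≡
    S 0 n m + ∑ (families n) λ P →
      ∑ P (λ B → 𝟙 (separates? r [ inside Vec.∷ B ])) * 𝟙 (isStirlingPartition? 0 (suc m) P)
  S-suc {r} r≤2 n m = begin
    S r (suc n) (suc m)
      ≡⟨ length-filter≡∑ _ (families (suc n)) ⟩
    ∑ (families (suc n)) w
      ≡⟨ ∑-sublists-++ (map (outside Vec.∷_) (subsets n)) (map (inside Vec.∷_) (subsets n)) w ⟩
    _ ≡⟨ ∑-sublists-map (inside Vec.∷_) (subsets n) _ ⟩
    _ ≡⟨ ∑-cong (families n) (λ Q → ∑-sublists-map (outside Vec.∷_) (subsets n) _) ⟩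
    ∑ (families n) (λ Q → ∑ (families n) λ P → w (map (outside Vec.∷_) P ++ map (inside Vec.∷_) Q))
      ≡⟨ ∑-cong (families n) (λ Q → ∑-cong (families n) λ P →
           𝟙-stirling-↭ r (suc m) (++-comm (map (outside Vec.∷_) P) (map (inside Vec.∷_) Q))) ⟩
    ∑ (families n) (λ Q → ∑ (families n) λ P → w (map (inside Vec.∷_) Q ++ map (outside Vec.∷_) P))
      ≡⟨ ∑-sublists-singletons (subsets n) _
           (∑-zero (families n) uncovered)
           (λ B C Q → ∑-zero (families n) (overlapping B C Q)) ⟩
    ∑ (subsets n) (λ B → ∑ (families n) λ P → w (adjoin B P))
      ≡⟨ ∑-cong (subsets n) (λ B → begin
           ∑ (families n) (λ P → w (adjoin B P))
             ≡⟨ ∑-cong (families n) (𝟙-adjoin r≤2 m B) ⟩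
           _ ≡⟨ ∑-+ (families n) _ _ ⟩
           _ ≡⟨ cong₂ _+_ (∑-*ˡ (e B) (families n) _) (∑-*ˡ (q B) (families n) _) ⟩
           e B * ∑ (families n) (part m) + q B * ∑ (families n) (part (suc m) ∘ (B ∷_)) ∎) ⟩
    _ ≡⟨ ∑-+ (subsets n) _ _ ⟩
    _ ≡⟨ cong₂ _+_ (∑-*ʳ _ (subsets n) e)
           (∑-marked q (subsets n) (part (suc m)) (𝟙-stirling-↭ 0 (suc m)) (𝟙-stirling-duplicate 0 (suc m))) ⟩
    ∑ (subsets n) e * ∑ (families n) (part m) + rest
      ≡⟨ cong (λ z → z * ∑ (families n) (part m) + rest) (∑-empty n) ⟩
    1 * ∑ (families n) (part m) + rest
      ≡⟨ cong (_+ rest) (*-identityˡ _) ⟩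
    ∑ (families n) (part m) + rest
      ≡⟨ cong (_+ rest) (length-filter≡∑ _ (families n)) ⟨
    S 0 n m + rest ∎
    where
    w : List (Subset (suc n)) → ℕ
    w = 𝟙 ∘ isStirlingPartition? r (suc m)
    part : ℕ → List (Subset n) → ℕ
    part m = 𝟙 ∘ isStirlingPartition? 0 m
    e q : Subset n → ℕ
    e B = 𝟙 (¬? (nonempty? B))
    q B = 𝟙 (separates? r [ inside Vec.∷ B ])
    rest = ∑ (families n) λ P → ∑ P q * part (suc m) P

    uncovered : ∀ P → w (map (outside Vec.∷_) P) ≡ 0
    uncovered P = 𝟙-false (isStirlingPartition? r (suc m) (map (outside Vec.∷_) P)) λ { ((_ , _ , cover) , _) →
      zero∉out (Any.satisfied (Any.map⁻ {f = outside Vec.∷_} (cover zero)) .proj₂) }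
      where
      zero∉out : ∀ {B : Subset n} → ¬ zero ∈ outside Vec.∷ B
      zero∉out ()

    overlapping : ∀ B C Q P → w (map (inside Vec.∷_) (B ∷ C ∷ Q) ++ map (outside Vec.∷_) P) ≡ 0
    overlapping B C Q P = 𝟙-false (isStirlingPartition? r (suc m) (map (inside Vec.∷_) (B ∷ C ∷ Q) ++ map (outside Vec.∷_) P))
      λ { ((_ , (d ∷ _) ∷ _ , _) , _) → d (zero , here) }

  ∑-const : ∀ (xs : List A) {f : A → ℕ} → (∀ x → f x ≡ 1) → ∑ xs f ≡ length xs
  ∑-const []       f≗1 = refl
  ∑-const (x ∷ xs) f≗1 = cong₂ _+_ (f≗1 x) (∑-const xs f≗1)

  S-suc-receivers : ∀ {r} → r ≤ 2 → ∀ n m c →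
    (∀ P → IsStirlingPartition {n} 0 (suc m) P → ∑ P (λ B → 𝟙 (separates? r [ inside Vec.∷ B ])) ≡ c) →
    S r (suc n) (suc m) ≡ S 0 n m + c * S 0 n (suc m)
  S-suc-receivers {r} r≤2 n m c receivers = trans (S-suc r≤2 n m) (cong (S 0 n m +_) (begin
    ∑ (families n) (λ P → ∑ P (λ B → 𝟙 (separates? r [ inside Vec.∷ B ])) * 𝟙 (part? P))
      ≡⟨ ∑-cong (families n) (λ P → *-𝟙-cong (part? P) (receivers P)) ⟩
    ∑ (families n) (λ P → c * 𝟙 (part? P))
      ≡⟨ ∑-*ˡ c (families n) (𝟙 ∘ part?) ⟩
    c * ∑ (families n) (𝟙 ∘ part?)
      ≡⟨ cong (c *_) (length-filter≡∑ part? (families n)) ⟨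
    c * S 0 n (suc m) ∎))
    where
    part? : (P : List (Subset n)) → Dec (IsStirlingPartition 0 (suc m) P)
    part? = isStirlingPartition? 0 (suc m)

  S₀-suc : ∀ n m → S 0 (suc n) (suc m) ≡ S 0 n m + suc m * S 0 n (suc m)
  S₀-suc n m = S-suc-receivers z≤n n m (suc m) λ { P (_ , len , _) →
    trans (∑-const P λ B → 𝟙-true (separates? 0 [ inside Vec.∷ B ]) (separates-0 _)) len }

  S₀-suc-0 : ∀ n → S 0 (suc n) 0 ≡ 0
  S₀-suc-0 n = trans (length-filter≡∑ _ (families (suc n)))
    (∑-zero (families (suc n)) λ P → 𝟙-false (isStirlingPartition? 0 0 P) (impossible P))
    where
    impossible : ∀ P → ¬ IsStirlingPartition 0 0 P
    impossible [] ((_ , _ , cover) , _) with () ← cover zero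

  separates-2 : ∀ {n} (B : Subset (suc n)) → Separates 2 [ inside Vec.∷ B ] ⇔ (¬ zero ∈ B)
  separates-2 B = mk⇔ (λ { (s ∷ []) 0∈B → case-0≡1 (s zero (suc zero) z<s (s<s z<s) here (there 0∈B)) }) λ 0∉B → separated 0∉B ∷ []
    where
    case-0≡1 : ∀ {n} {i : Fin n} → ¬ zero ≡ suc i
    case-0≡1 ()
    separated : ¬ zero ∈ B → ∀ i j → toℕ i < 2 → toℕ j < 2 → i ∈ inside Vec.∷ B → j ∈ inside Vec.∷ B → i ≡ j
    separated 0∉B zero          zero          _ _ _ _           = refl
    separated 0∉B _             (suc zero)    _ _ _ (there 0∈B) = contradiction 0∈B 0∉B
    separated 0∉B (suc zero)    _             _ _ (there 0∈B) _ = contradiction 0∈B 0∉B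
    separated 0∉B (suc (suc i)) _             (s<s (s<s ())) _ _ _
    separated 0∉B _             (suc (suc j)) _ (s<s (s<s ())) _ _

  ∑-avoiding : ∀ {n} (P : List (Subset (suc n))) → AllPairs Disjoint P → Any (zero ∈_) P →
    suc (∑ P λ B → 𝟙 (¬? (zero ∈? B))) ≡ length P
  ∑-avoiding (B ∷ P) (d ∷ ds) 0∈ with zero ∈? B
  ... | yes 0∈B = cong suc (all-avoid P (All.map (λ B∩C=∅ 0∈C → B∩C=∅ (zero , x∈p∩q⁺ (0∈B , 0∈C))) d))
    where
    all-avoid : ∀ Q → All (λ C → ¬ zero ∈ C) Q → (∑ Q λ C → 𝟙 (¬? (zero ∈? C))) ≡ length Q
    all-avoid []      []          = refl
    all-avoid (C ∷ Q) (0∉C ∷ 0∉Q) = cong₂ _+_ (𝟙-true (¬? (zero ∈? C)) 0∉C) (all-avoid Q 0∉Q)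
  ... | no 0∉B = cong suc (∑-avoiding P ds (Any.tail 0∉B 0∈))

  S₂-suc : ∀ n m → S 2 (suc (suc n)) (suc m) ≡ S 0 (suc n) m + m * S 0 (suc n) (suc m)
  S₂-suc n m = S-suc-receivers (s≤s (s≤s z≤n)) (suc n) m m λ { P ((_ , ds , cover) , len , _) →
    suc-injective (begin
      suc (∑ P λ B → 𝟙 (separates? 2 [ inside Vec.∷ B ]))
        ≡⟨ cong suc (∑-cong P λ B → 𝟙-cong (separates-2 B) (separates? 2 [ inside Vec.∷ B ]) (¬? (zero ∈? B))) ⟩
      suc (∑ P λ B → 𝟙 (¬? (zero ∈? B)))
        ≡⟨ ∑-avoiding P ds (cover zero) ⟩
      length P
        ≡⟨ len ⟩
      suc m ∎) }

  S₀-vanishes : ∀ {n m} → n < m → S 0 n m ≡ 0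
  S₀-vanishes {zero}  {suc m} _         = refl
  S₀-vanishes {suc n} {suc m} (s<s n<m) =
    trans (S₀-suc n m) (cong₂ _+_ (S₀-vanishes n<m)
      (trans (cong (suc m *_) (S₀-vanishes (m<n⇒m<1+n n<m))) (*-zeroʳ (suc m))))

  S₂-1 : ∀ n → S 2 (suc (suc n)) 1 ≡ 0
  S₂-1 n = trans (S₂-suc n 0) (cong (_+ 0) (S₀-suc-0 n))

  S₂-vanishes : ∀ {n m} → n < m → S 2 (suc (suc n)) (suc (suc m)) ≡ 0
  S₂-vanishes {n} {m} n<m = trans (S₂-suc n (suc m))
    (cong₂ _+_ (S₀-vanishes (s<s n<m))
      (trans (cong (suc m *_) (S₀-vanishes (s<s (m<n⇒m<1+n n<m)))) (*-zeroʳ (suc m))))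

  S₂-rec : ∀ n m → S 2 (suc (suc (suc n))) (suc (suc m)) ≡
    (2 + m) * S 2 (suc (suc n)) (suc (suc m)) + S 2 (suc (suc n)) (suc m)
  S₂-rec n m = begin
    S 2 (suc (suc (suc n))) (suc (suc m))
      ≡⟨ S₂-suc (suc n) (suc m) ⟩
    S 0 (suc (suc n)) (suc m) + suc m * S 0 (suc (suc n)) (suc (suc m))
      ≡⟨ cong₂ (λ x y → x + suc m * y) (S₀-suc (suc n) m) (S₀-suc (suc n) (suc m)) ⟩
    (a + suc m * b) + suc m * (b + suc (suc m) * c)
      ≡⟨ regroup m a b c ⟩
    (2 + m) * (b + suc m * c) + (a + m * b)
      ≡⟨ cong₂ (λ x y → (2 + m) * x + y) (S₂-suc n (suc m)) (S₂-suc n m) ⟨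
    (2 + m) * S 2 (suc (suc n)) (suc (suc m)) + S 2 (suc (suc n)) (suc m) ∎
    where
    a = S 0 (suc n) m
    b = S 0 (suc n) (suc m)
    c = S 0 (suc n) (suc (suc m))
    regroup : ∀ m a b c → (a + (1 + m) * b) + (1 + m) * (b + (2 + m) * c) ≡ (2 + m) * (b + (1 + m) * c) + (a + m * b)
    regroup = solve-∀

module Series where

  open Counting
  open import Data.Integer using (ℤ; +_; -_; _+_; _*_; _-_; _^_; 0ℤ; 1ℤ; -1ℤ)
  open import Data.Integer.Properties using (pos-+; pos-*; *-zeroʳ; *-zeroˡ; *-distribˡ-+; ^-distribˡ-+-*; ^-*-assoc; ^-zeroˡ; +-identityʳ; *-assoc; *-comm)
  open import Data.Integer.Divisibility.Signed using (_∣_; divides; ∣⇒∣ᵤ; ∣m∣n⇒∣m+n; ∣m∣n⇒∣m-n; ∣n⇒∣m*n; ∣m⇒∣m*n; ∣-reflexive; ∣-trans; *-monoʳ-∣; *-monoˡ-∣)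
  open import Data.Integer.Divisibility using () renaming (_∣_ to _∣ᵤ_)
  open import Data.Integer.Tactic.RingSolver using (solve-∀)

  ∑< : ℕ → (ℕ → ℤ) → ℤ
  ∑< zero    f = 0ℤ
  ∑< (suc N) f = ∑< N f + f N

  ∑<-cong : ∀ N {f g} → (∀ k → f k ≡ g k) → ∑< N f ≡ ∑< N g
  ∑<-cong zero    f≗g = refl
  ∑<-cong (suc N) f≗g = cong₂ _+_ (∑<-cong N f≗g) (f≗g N)

  ∑<-+ : ∀ N f g → ∑< N (λ k → f k + g k) ≡ ∑< N f + ∑< N g
  ∑<-+ zero    f g = refl
  ∑<-+ (suc N) f g = trans (cong (_+ (f N + g N)) (∑<-+ N f g)) (interchange (∑< N f) (∑< N g) (f N) (g N))
    where
    interchange : ∀ a b c d → (a + b) + (c + d) ≡ (a + c) + (b + d)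
    interchange = solve-∀

  ∑<-*ˡ : ∀ c N f → ∑< N (λ k → c * f k) ≡ c * ∑< N f
  ∑<-*ˡ c zero    f = sym (*-zeroʳ c)
  ∑<-*ˡ c (suc N) f = trans (cong (_+ c * f N) (∑<-*ˡ c N f)) (sym (*-distribˡ-+ c (∑< N f) (f N)))

  ∑<-swap : ∀ M N (f : ℕ → ℕ → ℤ) → ∑< M (λ i → ∑< N (f i)) ≡ ∑< N (λ j → ∑< M (λ i → f i j))
  ∑<-swap zero    N f = sym (trans (∑<-*ˡ 0ℤ N (λ _ → 0ℤ)) (*-zeroˡ (∑< N (λ _ → 0ℤ))))
  ∑<-swap (suc M) N f = trans (cong (_+ ∑< N (f M)) (∑<-swap M N f)) (sym (∑<-+ N (λ j → ∑< M (λ i → f i j)) (f M)))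

  ∣-∑< : ∀ {d} N {f} → (∀ k → d ∣ f k) → d ∣ ∑< N f
  ∣-∑< zero    d∣f = divides 0ℤ refl
  ∣-∑< (suc N) d∣f = ∣m∣n⇒∣m+n (∣-∑< N d∣f) (d∣f N)

  +-sum-upTo : ∀ (f : ℕ → ℕ) N → + sum (map f (upTo N)) ≡ ∑< N (λ k → + f k)
  +-sum-upTo f zero    = refl
  +-sum-upTo f (suc N) = begin
    + sum (map f (upTo (suc N)))
      ≡⟨ cong (λ ks → + sum (map f ks)) (upTo-∷ʳ N) ⟨
    + ∑ (upTo N ++ [ N ]) f
      ≡⟨ cong +_ (∑-++ (upTo N) [ N ] f) ⟩
    + (sum (map f (upTo N)) ℕ.+ (f N ℕ.+ 0))
      ≡⟨ cong (λ x → + (sum (map f (upTo N)) ℕ.+ x)) (ℕ.+-identityʳ (f N)) ⟩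
    + (sum (map f (upTo N)) ℕ.+ f N)
      ≡⟨ pos-+ (sum (map f (upTo N))) (f N) ⟩
    + sum (map f (upTo N)) + + f N
      ≡⟨ cong (_+ + f N) (+-sum-upTo f N) ⟩
    ∑< (suc N) (λ k → + f k) ∎

  -- binom j k is the binomial coefficient (j+k choose k).
  binom : ℕ → ℕ → ℕ
  binom zero    k       = 1
  binom (suc j) zero    = 1
  binom (suc j) (suc k) = binom j (suc k) ℕ.+ binom (suc j) k

  binom-0 : ∀ j → binom j 0 ≡ 1
  binom-0 zero    = refl
  binom-0 (suc j) = refl

  mutual
    binom-absorbʳ : ∀ j k → suc k ℕ.* binom j (suc k) ≡ (suc j ℕ.+ k) ℕ.* binom j k
    binom-absorbʳ zero    k = refl
    binom-absorbʳ (suc j) k = begin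
      suc k ℕ.* (binom j (suc k) ℕ.+ binom (suc j) k)
        ≡⟨ ℕ.*-distribˡ-+ (suc k) (binom j (suc k)) (binom (suc j) k) ⟩
      suc k ℕ.* binom j (suc k) ℕ.+ suc k ℕ.* binom (suc j) k
        ≡⟨ cong (ℕ._+ suc k ℕ.* binom (suc j) k) (trans (binom-absorbʳ j k) (sym (binom-absorbˡ j k))) ⟩
      suc j ℕ.* binom (suc j) k ℕ.+ suc k ℕ.* binom (suc j) k
        ≡⟨ collect j k (binom (suc j) k) ⟩
      (suc (suc j) ℕ.+ k) ℕ.* binom (suc j) k ∎
      where
      collect : ∀ j k b → (1 ℕ.+ j) ℕ.* b ℕ.+ (1 ℕ.+ k) ℕ.* b ≡ (2 ℕ.+ j ℕ.+ k) ℕ.* b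
      collect = ℕ-Solver.solve-∀

    binom-absorbˡ : ∀ j k → suc j ℕ.* binom (suc j) k ≡ (suc j ℕ.+ k) ℕ.* binom j k
    binom-absorbˡ j zero    = cong₂ ℕ._*_ (sym (ℕ.+-identityʳ (suc j))) (sym (binom-0 j))
    binom-absorbˡ j (suc k) = begin
      suc j ℕ.* (binom j (suc k) ℕ.+ binom (suc j) k)
        ≡⟨ ℕ.*-distribˡ-+ (suc j) (binom j (suc k)) (binom (suc j) k) ⟩
      suc j ℕ.* binom j (suc k) ℕ.+ suc j ℕ.* binom (suc j) k
        ≡⟨ cong (suc j ℕ.* binom j (suc k) ℕ.+_) (trans (binom-absorbˡ j k) (sym (binom-absorbʳ j k))) ⟩
      suc j ℕ.* binom j (suc k) ℕ.+ suc k ℕ.* binom j (suc k)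
        ≡⟨ ℕ.*-distribʳ-+ (binom j (suc k)) (suc j) (suc k) ⟨
      (suc j ℕ.+ suc k) ℕ.* binom j (suc k) ∎

  binom-2 : ∀ j → 2 ℕ.* binom j 2 ≡ suc j ℕ.* suc (suc j)
  binom-2 j = begin
    2 ℕ.* binom j 2              ≡⟨ binom-absorbʳ j 1 ⟩
    (suc j ℕ.+ 1) ℕ.* binom j 1  ≡⟨ cong ((suc j ℕ.+ 1) ℕ.*_) (trans (sym (ℕ.*-identityˡ _)) (trans (binom-absorbʳ j 0) (cong ((suc j ℕ.+ 0) ℕ.*_) (binom-0 j)))) ⟩
    (suc j ℕ.+ 1) ℕ.* ((suc j ℕ.+ 0) ℕ.* 1) ≡⟨ tidy j ⟩
    suc j ℕ.* suc (suc j) ∎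
    where
    tidy : ∀ j → (1 ℕ.+ j ℕ.+ 1) ℕ.* ((1 ℕ.+ j ℕ.+ 0) ℕ.* 1) ≡ (1 ℕ.+ j) ℕ.* (2 ℕ.+ j)
    tidy = ℕ-Solver.solve-∀

  sgn : ℕ → ℤ
  sgn k = -1ℤ ^ k

  sgn² : ∀ k → sgn k * sgn k ≡ 1ℤ
  sgn² zero    = refl
  sgn² (suc k) = trans (drop (sgn k)) (sgn² k)
    where
    drop : ∀ s → (-1ℤ * s) * (-1ℤ * s) ≡ s * s
    drop = solve-∀

  -- The 2-adic identity ∑ⱼ 2ʲ (j+k choose k) = (1 - 2)⁻⁽ᵏ⁺¹⁾, truncated.
  geometric : ℕ → ℕ → ℤ
  geometric N k = ∑< N λ j → (+ 2) ^ j * + binom j k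

  geometric-0 : ∀ N → geometric N 0 + 1ℤ ≡ (+ 2) ^ N
  geometric-0 zero    = refl
  geometric-0 (suc N) = begin
    (geometric N 0 + (+ 2) ^ N * + binom N 0) + 1ℤ
      ≡⟨ cong (λ b → (geometric N 0 + (+ 2) ^ N * + b) + 1ℤ) (binom-0 N) ⟩
    (geometric N 0 + (+ 2) ^ N * 1ℤ) + 1ℤ
      ≡⟨ shuffle (geometric N 0) ((+ 2) ^ N) ⟩
    (geometric N 0 + 1ℤ) + (+ 2) ^ N
      ≡⟨ cong (_+ (+ 2) ^ N) (geometric-0 N) ⟩
    (+ 2) ^ N + (+ 2) ^ N
      ≡⟨ double ((+ 2) ^ N) ⟩
    (+ 2) ^ suc N ∎
    where
    shuffle : ∀ g p → (g + p * 1ℤ) + 1ℤ ≡ (g + 1ℤ) + p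
    shuffle = solve-∀
    double : ∀ p → p + p ≡ + 2 * p
    double = solve-∀

  geometric-suc : ∀ N k → (+ 2) ^ N ∣ geometric N (suc k) + geometric N k
  geometric-suc N k = divides (+ binom⁻ N) (trans (exact N) (*-comm ((+ 2) ^ N) (+ binom⁻ N)))
    where
    binom⁻ : ℕ → ℕ
    binom⁻ zero    = 0
    binom⁻ (suc N) = binom N (suc k)

    pascal : ∀ N → binom N (suc k) ≡ binom⁻ N ℕ.+ binom N k
    pascal zero    = refl
    pascal (suc N) = refl

    combine : ∀ g h p a b → (g + p * (a + b)) + (h + p * b) ≡ (g + h) + p * (a + + 2 * b)
    combine = solve-∀
    collect : ∀ p a b → p * a + p * (a + + 2 * b) ≡ + 2 * p * (a + b)
    collect = solve-∀

    exact : ∀ N → geometric N (suc k) + geometric N k ≡ (+ 2) ^ N * + binom⁻ N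
    exact zero    = refl
    exact (suc N) = begin
      (geometric N (suc k) + p * + binom N (suc k)) + (geometric N k + p * b)
        ≡⟨ cong (λ c → (geometric N (suc k) + p * c) + (geometric N k + p * b)) pascalℤ ⟩
      (geometric N (suc k) + p * (a + b)) + (geometric N k + p * b)
        ≡⟨ combine (geometric N (suc k)) (geometric N k) p a b ⟩
      (geometric N (suc k) + geometric N k) + p * (a + + 2 * b)
        ≡⟨ cong (_+ p * (a + + 2 * b)) (exact N) ⟩
      p * a + p * (a + + 2 * b)
        ≡⟨ collect p a b ⟩
      + 2 * p * (a + b)
        ≡⟨ cong (+ 2 * p *_) pascalℤ ⟨
      + 2 * p * + binom N (suc k) ∎
      where
      p = (+ 2) ^ N
      a = + binom⁻ N
      b = + binom N k
      pascalℤ : + binom N (suc k) ≡ a + b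
      pascalℤ = trans (cong +_ (pascal N)) (pos-+ (binom⁻ N) (binom N k))

  geometric-≡-sgn : ∀ N k → (+ 2) ^ N ∣ geometric N k + sgn k
  geometric-≡-sgn N zero    = ∣-reflexive (sym (geometric-0 N))
  geometric-≡-sgn N (suc k) = subst ((+ 2) ^ N ∣_) (difference (geometric N (suc k)) (geometric N k) (sgn k))
    (∣m∣n⇒∣m-n (geometric-suc N k) (geometric-≡-sgn N k))
    where
    difference : ∀ g h s → (g + h) - (h + s) ≡ g + -1ℤ * s
    difference = solve-∀

  eigenvector : ℕ → ℕ → ℤ
  eigenvector j k = sgn k * + binom j (2 ℕ.+ k)

  eigenvector-shift : ∀ j k →
    + (2 ℕ.+ k) * eigenvector j k + + (3 ℕ.+ k) * eigenvector j (suc k) ≡ - + suc j * eigenvector j k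
  eigenvector-shift j k = begin
    + (2 ℕ.+ k) * (s * b) + + (3 ℕ.+ k) * (-1ℤ * s * b′)
      ≡⟨ gather (+ (2 ℕ.+ k)) (+ (3 ℕ.+ k)) s b b′ ⟩
    s * (+ (2 ℕ.+ k) * b - + (3 ℕ.+ k) * b′)
      ≡⟨ cong (λ x → s * (+ (2 ℕ.+ k) * b - x)) absorb ⟩
    s * (+ (2 ℕ.+ k) * b - (+ suc j + + (2 ℕ.+ k)) * b)
      ≡⟨ cancel (+ (2 ℕ.+ k)) (+ suc j) s b ⟩
    - + suc j * (s * b) ∎
    where
    s = sgn k
    b = + binom j (2 ℕ.+ k)
    b′ = + binom j (3 ℕ.+ k)
    gather : ∀ x y s b b′ → x * (s * b) + y * (-1ℤ * s * b′) ≡ s * (x * b - y * b′)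
    gather = solve-∀
    cancel : ∀ x y s b → s * (x * b - (y + x) * b) ≡ - y * (s * b)
    cancel = solve-∀
    absorb : + (3 ℕ.+ k) * b′ ≡ (+ suc j + + (2 ℕ.+ k)) * b
    absorb = begin
      + (3 ℕ.+ k) * b′ ≡⟨ pos-* (3 ℕ.+ k) (binom j (3 ℕ.+ k)) ⟨
      + ((3 ℕ.+ k) ℕ.* binom j (3 ℕ.+ k)) ≡⟨ cong +_ (binom-absorbʳ j (2 ℕ.+ k)) ⟩
      + ((suc j ℕ.+ (2 ℕ.+ k)) ℕ.* binom j (2 ℕ.+ k)) ≡⟨ pos-* (suc j ℕ.+ (2 ℕ.+ k)) (binom j (2 ℕ.+ k)) ⟩
      + (suc j ℕ.+ (2 ℕ.+ k)) * b ≡⟨ cong (_* b) (pos-+ (suc j) (2 ℕ.+ k)) ⟩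
      (+ suc j + + (2 ℕ.+ k)) * b ∎

  ∑-eigenvectors : ∀ N k → (+ 2) ^ N ∣ 1ℤ + ∑< N (λ j → (+ 2) ^ j * eigenvector j k)
  ∑-eigenvectors N k = subst ((+ 2) ^ N ∣_) (begin
    sgn k * (g + -1ℤ * (-1ℤ * sgn k))
      ≡⟨ expand (sgn k) g ⟩
    sgn k * sgn k + sgn k * g
      ≡⟨ cong₂ _+_ (sgn² k) (sym (∑<-*ˡ (sgn k) N _)) ⟩
    1ℤ + ∑< N (λ j → sgn k * ((+ 2) ^ j * + binom j (2 ℕ.+ k)))
      ≡⟨ cong (λ z → 1ℤ + z) (∑<-cong N λ j → exchange (sgn k) ((+ 2) ^ j) (+ binom j (2 ℕ.+ k))) ⟩
    1ℤ + ∑< N (λ j → (+ 2) ^ j * eigenvector j k) ∎)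
    (∣n⇒∣m*n (sgn k) (geometric-≡-sgn N (2 ℕ.+ k)))
    where
    g = geometric N (2 ℕ.+ k)
    expand : ∀ s g → s * (g + -1ℤ * (-1ℤ * s)) ≡ s * s + s * g
    expand = solve-∀
    exchange : ∀ s p b → s * (p * b) ≡ p * (s * b)
    exchange = solve-∀

  -- The term i = j + 1 of the 2-adic series for -F_{n,2}.
  seriesTerm : ℕ → ℕ → ℤ
  seriesTerm n j = (+ 2) ^ j * ((- + suc j) ^ n * + (suc j ℕ.* suc (suc j)))

  module Triangle
    (T : ℕ → ℕ → ℤ)
    (T-0-0     : T 0 0 ≡ + 2)
    (T-suc-0   : ∀ n → T (suc n) 0 ≡ + 2 * T n 0)
    (T-suc-suc : ∀ n k → T (suc n) (suc k) ≡ + (3 ℕ.+ k) * (T n (suc k) + T n k))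
    (T-diag    : ∀ n → T n (suc n) ≡ 0ℤ)
    where

    adjoint : ∀ n N (a : ℕ → ℤ) → ∑< (suc N) (λ k → T (suc n) k * a k) ≡
      ∑< N (λ k → T n k * (+ (2 ℕ.+ k) * a k + + (3 ℕ.+ k) * a (suc k))) + T n N * (+ (2 ℕ.+ N) * a N)
    adjoint n zero    a = trans (cong (λ t → 0ℤ + t * a 0) (T-suc-0 n)) (reassoc (T n 0) (a 0))
      where
      reassoc : ∀ t a → 0ℤ + + 2 * t * a ≡ 0ℤ + t * (+ 2 * a)
      reassoc = solve-∀
    adjoint n (suc N) a = begin
      ∑< (suc N) (λ k → T (suc n) k * a k) + T (suc n) (suc N) * a (suc N)
        ≡⟨ cong₂ _+_ (adjoint n N a) (cong (_* a (suc N)) (T-suc-suc n N)) ⟩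
      (r + T n N * (x * a N)) + y * (T n (suc N) + T n N) * a (suc N)
        ≡⟨ regroup r (T n N) (T n (suc N)) x y (a N) (a (suc N)) ⟩
      (r + T n N * (x * a N + y * a (suc N))) + T n (suc N) * (y * a (suc N)) ∎
      where
      r = ∑< N (λ k → T n k * (+ (2 ℕ.+ k) * a k + + (3 ℕ.+ k) * a (suc k)))
      x = + (2 ℕ.+ N)
      y = + (3 ℕ.+ N)
      regroup : ∀ r t t′ x y a a′ →
        (r + t * (x * a)) + y * (t′ + t) * a′ ≡ (r + t * (x * a + y * a′)) + t′ * (y * a′)
      regroup = solve-∀

    moment : ∀ j n → ∑< (suc n) (λ k → T n k * eigenvector j k) ≡
      (- + suc j) ^ n * + (suc j ℕ.* suc (suc j))
    moment j zero    = begin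
      0ℤ + T 0 0 * (1ℤ * + binom j 2) ≡⟨ cong (λ t → 0ℤ + t * (1ℤ * + binom j 2)) T-0-0 ⟩
      0ℤ + + 2 * (1ℤ * + binom j 2)   ≡⟨ tidy (+ binom j 2) ⟩
      1ℤ * (+ 2 * + binom j 2)        ≡⟨ cong (1ℤ *_) (trans (sym (pos-* 2 (binom j 2))) (cong +_ (binom-2 j))) ⟩
      1ℤ * + (suc j ℕ.* suc (suc j))  ∎
      where
      tidy : ∀ b → 0ℤ + + 2 * (1ℤ * b) ≡ 1ℤ * (+ 2 * b)
      tidy = solve-∀
    moment j (suc n) = begin
      ∑< (suc (suc n)) (λ k → T (suc n) k * e k)
        ≡⟨ adjoint n (suc n) e ⟩
      ∑< (suc n) (λ k → T n k * (+ (2 ℕ.+ k) * e k + + (3 ℕ.+ k) * e (suc k))) + T n (suc n) * (+ (3 ℕ.+ n) * e (suc n))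
        ≡⟨ cong₂ _+_ (∑<-cong (suc n) λ k → trans (cong (T n k *_) (eigenvector-shift j k)) (exchange (T n k) (- + suc j) (e k)))
                     (trans (cong (_* (+ (3 ℕ.+ n) * e (suc n))) (T-diag n)) (*-zeroˡ (+ (3 ℕ.+ n) * e (suc n)))) ⟩
      ∑< (suc n) (λ k → - + suc j * (T n k * e k)) + 0ℤ
        ≡⟨ +-identityʳ _ ⟩
      ∑< (suc n) (λ k → - + suc j * (T n k * e k))
        ≡⟨ ∑<-*ˡ (- + suc j) (suc n) (λ k → T n k * e k) ⟩
      - + suc j * ∑< (suc n) (λ k → T n k * e k)
        ≡⟨ cong (- + suc j *_) (moment j n) ⟩
      - + suc j * ((- + suc j) ^ n * + (suc j ℕ.* suc (suc j)))
        ≡⟨ *-assoc (- + suc j) ((- + suc j) ^ n) (+ (suc j ℕ.* suc (suc j))) ⟨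
      (- + suc j) ^ suc n * + (suc j ℕ.* suc (suc j)) ∎
      where
      e = eigenvector j
      exchange : ∀ t x e → t * (x * e) ≡ x * (t * e)
      exchange = solve-∀

    row-sum-series : ∀ N n → (+ 2) ^ N ∣ ∑< (suc n) (T n) + ∑< N (seriesTerm n)
    row-sum-series N n = subst ((+ 2) ^ N ∣_) (begin
      ∑< (suc n) (λ k → T n k * (1ℤ + ∑< N (λ j → (+ 2) ^ j * eigenvector j k)))
        ≡⟨ ∑<-cong (suc n) (λ k → trans (distribute (T n k) _) (cong (λ z → T n k + z) (sym (∑<-*ˡ (T n k) N _)))) ⟩
      ∑< (suc n) (λ k → T n k + ∑< N (λ j → T n k * ((+ 2) ^ j * eigenvector j k)))
        ≡⟨ ∑<-+ (suc n) (T n) _ ⟩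
      ∑< (suc n) (T n) + ∑< (suc n) (λ k → ∑< N (λ j → T n k * ((+ 2) ^ j * eigenvector j k)))
        ≡⟨ cong (λ z → ∑< (suc n) (T n) + z) (∑<-swap (suc n) N _) ⟩
      ∑< (suc n) (T n) + ∑< N (λ j → ∑< (suc n) (λ k → T n k * ((+ 2) ^ j * eigenvector j k)))
        ≡⟨ cong (λ z → ∑< (suc n) (T n) + z) (∑<-cong N λ j →
             trans (∑<-cong (suc n) λ k → exchange (T n k) ((+ 2) ^ j) (eigenvector j k))
             (trans (∑<-*ˡ ((+ 2) ^ j) (suc n) (λ k → T n k * eigenvector j k)) (cong ((+ 2) ^ j *_) (moment j n)))) ⟩
      ∑< (suc n) (T n) + ∑< N (seriesTerm n) ∎)
      (∣-∑< (suc n) λ k → ∣n⇒∣m*n (T n k) (∑-eigenvectors N k))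
      where
      distribute : ∀ t x → t * (1ℤ + x) ≡ t + t * x
      distribute = solve-∀
      exchange : ∀ t p e → t * (p * e) ≡ p * (t * e)
      exchange = solve-∀

  fubiniTerm : ℕ → ℕ → ℕ
  fubiniTerm n k = (2 ℕ.+ k) ! ℕ.* S 2 (2 ℕ.+ n) (2 ℕ.+ k)

  F-as-row-sum : ∀ n → + F n 2 ≡ ∑< (suc n) (λ k → + fubiniTerm n k)
  F-as-row-sum n = trans (+-sum-upTo _ (suc n)) (∑<-cong (suc n) λ k →
    cong₂ (λ a b → + (b ! ℕ.* S 2 a b)) (ℕ.+-comm n 2) (ℕ.+-comm k 2))

  F-series : ∀ N n → (+ 2) ^ N ∣ + F n 2 + ∑< N (seriesTerm n)
  F-series N n = subst (λ f → (+ 2) ^ N ∣ f + ∑< N (seriesTerm n)) (sym (F-as-row-sum n))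
    (Triangle.row-sum-series (λ n k → + fubiniTerm n k) initial first-column recurrence diagonal N n)
    where
    initial : + fubiniTerm 0 0 ≡ + 2
    initial = cong (λ s → + (2 ℕ.* s)) (S₂-suc 0 1)

    first-column : ∀ n → + fubiniTerm (suc n) 0 ≡ + 2 * + fubiniTerm n 0
    first-column n = begin
      + (2 ℕ.* S 2 (3 ℕ.+ n) 2)
        ≡⟨ cong (λ s → + (2 ℕ.* s)) (trans (S₂-rec n 0) (trans (cong (2 ℕ.* s ℕ.+_) (S₂-1 n)) (ℕ.+-identityʳ (2 ℕ.* s)))) ⟩
      + (2 ℕ.* (2 ℕ.* s))
        ≡⟨ pos-* 2 (2 ℕ.* s) ⟩
      + 2 * + (2 ℕ.* s) ∎
      where s = S 2 (2 ℕ.+ n) 2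

    recurrence : ∀ n k → + fubiniTerm (suc n) (suc k) ≡
      + (3 ℕ.+ k) * (+ fubiniTerm n (suc k) + + fubiniTerm n k)
    recurrence n k = begin
      + ((3 ℕ.+ k) ! ℕ.* S 2 (3 ℕ.+ n) (3 ℕ.+ k))
        ≡⟨ cong (λ s → + ((3 ℕ.+ k) ! ℕ.* s)) (S₂-rec n (suc k)) ⟩
      + ((3 ℕ.+ k) ℕ.* f ℕ.* ((3 ℕ.+ k) ℕ.* s′ ℕ.+ s))
        ≡⟨ cong +_ (factor (3 ℕ.+ k) f s′ s) ⟩
      + ((3 ℕ.+ k) ℕ.* ((3 ℕ.+ k) ℕ.* f ℕ.* s′ ℕ.+ f ℕ.* s))
        ≡⟨ pos-* (3 ℕ.+ k) (fubiniTerm n (suc k) ℕ.+ fubiniTerm n k) ⟩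
      + (3 ℕ.+ k) * + (fubiniTerm n (suc k) ℕ.+ fubiniTerm n k)
        ≡⟨ cong (+ (3 ℕ.+ k) *_) (pos-+ (fubiniTerm n (suc k)) (fubiniTerm n k)) ⟩
      + (3 ℕ.+ k) * (+ fubiniTerm n (suc k) + + fubiniTerm n k) ∎
      where
      f = (2 ℕ.+ k) !
      s = S 2 (2 ℕ.+ n) (2 ℕ.+ k)
      s′ = S 2 (2 ℕ.+ n) (3 ℕ.+ k)
      factor : ∀ x f s′ s → x ℕ.* f ℕ.* (x ℕ.* s′ ℕ.+ s) ≡ x ℕ.* (x ℕ.* f ℕ.* s′ ℕ.+ f ℕ.* s)
      factor = ℕ-Solver.solve-∀

    diagonal : ∀ n → + fubiniTerm n (suc n) ≡ 0ℤ
    diagonal n = cong +_ (trans (cong ((3 ℕ.+ n) ! ℕ.*_) (S₂-vanishes (ℕ.n<1+n n))) (ℕ.*-zeroʳ ((3 ℕ.+ n) !)))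

  -- Periodicity of the series

  2∣t[t+1] : ∀ t → + 2 ∣ + t * + suc t
  2∣t[t+1] zero    = divides 0ℤ refl
  2∣t[t+1] (suc t) = subst (+ 2 ∣_) (step (+ t)) (∣m∣n⇒∣m+n (2∣t[t+1] t) (∣m⇒∣m*n (+ suc t) (∣-reflexive refl)))
    where
    step : ∀ t → t * (1ℤ + t) + + 2 * (1ℤ + t) ≡ (1ℤ + t) * (+ 2 + t)
    step = solve-∀

  odd-power : ∀ t e → (+ 2) ^ (3 ℕ.+ e) ∣ (- + suc (2 ℕ.* t)) ^ (2 ℕ.^ suc e) - 1ℤ
  odd-power t zero    = subst (+ 8 ∣_)
    (trans (square (+ t)) (cong (λ y → (- (1ℤ + y)) ^ 2 - 1ℤ) (sym (pos-* 2 t))))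
    (*-monoʳ-∣ (+ 4) (2∣t[t+1] t))
    where
    square : ∀ t → + 4 * (t * (1ℤ + t)) ≡ (- (1ℤ + + 2 * t)) * ((- (1ℤ + + 2 * t)) * 1ℤ) - 1ℤ
    square = solve-∀
  odd-power t (suc e) with odd-power t e
  ... | divides q u-1≡qd = divides (q * (q * (+ 2) ^ (2 ℕ.+ e) + 1ℤ)) (begin
    x ^ (2 ℕ.* p) - 1ℤ                  ≡⟨ cong (_- 1ℤ) (^-distribˡ-+-* x p (p ℕ.+ 0)) ⟩
    u * x ^ (p ℕ.+ 0) - 1ℤ              ≡⟨ cong (λ p → u * x ^ p - 1ℤ) (ℕ.+-identityʳ p) ⟩
    u * u - 1ℤ                          ≡⟨ factor u ⟩
    (u - 1ℤ) * ((u - 1ℤ) + + 2)         ≡⟨ cong (λ z → z * (z + + 2)) u-1≡qd ⟩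
    (q * (+ 2 * d)) * (q * (+ 2 * d) + + 2) ≡⟨ collect q d ⟩
    q * (q * d + 1ℤ) * (+ 2 * (+ 2 * d)) ∎)
    where
    x = - + suc (2 ℕ.* t)
    p = 2 ℕ.^ suc e
    u = x ^ p
    d = (+ 2) ^ (2 ℕ.+ e)
    factor : ∀ u → u * u - 1ℤ ≡ (u - 1ℤ) * ((u - 1ℤ) + + 2)
    factor = solve-∀
    collect : ∀ q d → (q * (+ 2 * d)) * (q * (+ 2 * d) + + 2) ≡ q * (q * d + 1ℤ) * (+ 2 * (+ 2 * d))
    collect = solve-∀

  even-or-odd : ∀ j → ∃ λ t → j ≡ 2 ℕ.* t ⊎ j ≡ suc (2 ℕ.* t)
  even-or-odd zero = 0 , inj₁ refl
  even-or-odd (suc j) with even-or-odd j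
  ... | t , inj₁ eq = t , inj₂ (cong suc eq)
  ... | t , inj₂ eq = suc t , inj₁ (trans (cong suc eq) (sym (ℕ.*-suc 2 t)))

  2^-mono-∣ : ∀ {m n} → m ≤ n → (+ 2) ^ m ∣ (+ 2) ^ n
  2^-mono-∣ {m} {n} m≤n = subst (λ k → (+ 2) ^ m ∣ (+ 2) ^ k) (ℕ.m+[n∸m]≡n m≤n)
    (subst ((+ 2) ^ m ∣_) (sym (^-distribˡ-+-* (+ 2) m (n ∸ m))) (∣m⇒∣m*n ((+ 2) ^ (n ∸ m)) (∣-reflexive refl)))

  2^∣even^ : ∀ y n → (+ 2) ^ n ∣ (+ 2 * y) ^ n
  2^∣even^ y zero    = ∣-reflexive refl
  2^∣even^ y (suc n) = subst ((+ 2) ^ suc n ∣_) (sym (*-assoc (+ 2) y ((+ 2 * y) ^ n)))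
    (*-monoʳ-∣ (+ 2) (∣n⇒∣m*n y (2^∣even^ y n)))

  seriesTerm-odd : ∀ t {m n} → m ≤ suc n → (+ 2) ^ m ∣ seriesTerm n (suc (2 ℕ.* t))
  seriesTerm-odd t {m} {n} m≤1+n = ∣n⇒∣m*n ((+ 2) ^ j) (subst ((+ 2) ^ m ∣_) (begin
    - + suc (suc j) * (x * x ^ n)
      ≡⟨ reorder (+ suc (suc j)) (+ suc j) (x ^ n) ⟩
    x ^ n * (+ suc j * + suc (suc j))
      ≡⟨ cong (x ^ n *_) (pos-* (suc j) (suc (suc j))) ⟨
    x ^ n * + (suc j ℕ.* suc (suc j)) ∎)
    (∣n⇒∣m*n (- + suc (suc j)) (∣-trans (2^-mono-∣ m≤1+n)
      (subst (λ z → (+ 2) ^ suc n ∣ z ^ suc n) x-even (2^∣even^ (- + suc t) (suc n))))))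
    where
    j = suc (2 ℕ.* t)
    x = - + suc j
    reorder : ∀ a b p → - a * ((- b) * p) ≡ p * (b * a)
    reorder = solve-∀
    neg : ∀ s → + 2 * (- s) ≡ - (+ 2 * s)
    neg = solve-∀
    x-even : + 2 * (- + suc t) ≡ x
    x-even = trans (neg (+ suc t)) (cong -_ (trans (sym (pos-* 2 (suc t))) (cong +_ (ℕ.*-suc 2 t))))

  -- Makes up for odd powers being 2ᵐ⁻⁶-periodic only modulo 2ᵐ⁻⁴.
  16∣4^t[2t+2] : ∀ t → + 16 ∣ (+ 2) ^ (2 ℕ.* suc t) * + (2 ℕ.+ 2 ℕ.* suc t)
  16∣4^t[2t+2] zero    = ∣-reflexive refl
  16∣4^t[2t+2] (suc t) = ∣m⇒∣m*n (+ (2 ℕ.+ 2 ℕ.* suc (suc t))) (2^-mono-∣ {4} {2 ℕ.* suc (suc t)} (ℕ.*-monoʳ-≤ 2 (ℕ.s≤s (ℕ.s≤s ℕ.z≤n))))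

  seriesTerm-difference : ∀ n p j → seriesTerm (n ℕ.+ p) j - seriesTerm n j ≡
    ((+ 2) ^ j * + suc (suc j)) * ((- + suc j) ^ p - 1ℤ) * ((- + suc j) ^ n * + suc j)
  seriesTerm-difference n p j = trans
    (cong₂ (λ y c → (+ 2) ^ j * (y * c) - (+ 2) ^ j * (x ^ n * c)) (^-distribˡ-+-* x n p) (pos-* (suc j) (suc (suc j))))
    (factor ((+ 2) ^ j) (x ^ n) (x ^ p) (+ suc j) (+ suc (suc j)))
    where
    x = - + suc j
    factor : ∀ a b c d f → a * (b * c * (d * f)) - a * (b * (d * f)) ≡ (a * f) * (c - 1ℤ) * (b * d)
    factor = solve-∀

  seriesTerm-even : ∀ t e n →
    (+ 2) ^ (7 ℕ.+ e) ∣ seriesTerm (n ℕ.+ 2 ℕ.^ suc e) (2 ℕ.* t) - seriesTerm n (2 ℕ.* t)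
  seriesTerm-even t e n = subst ((+ 2) ^ (7 ℕ.+ e) ∣_) (sym (seriesTerm-difference n (2 ℕ.^ suc e) (2 ℕ.* t)))
    (∣m⇒∣m*n ((- + suc (2 ℕ.* t)) ^ n * + suc (2 ℕ.* t)) (divisible t))
    where
    p = 2 ℕ.^ suc e
    divisible : ∀ t → (+ 2) ^ (7 ℕ.+ e) ∣ ((+ 2) ^ (2 ℕ.* t) * + (2 ℕ.+ 2 ℕ.* t)) * ((- + suc (2 ℕ.* t)) ^ p - 1ℤ)
    divisible zero    = divides 0ℤ (cong (λ u → + 2 * (u - 1ℤ)) (begin
      -1ℤ ^ (2 ℕ.* 2 ℕ.^ e) ≡⟨ ^-*-assoc -1ℤ 2 (2 ℕ.^ e) ⟨
      1ℤ ^ (2 ℕ.^ e)        ≡⟨ ^-zeroˡ (2 ℕ.^ e) ⟩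
      1ℤ                    ∎))
    divisible (suc t) = subst (_∣ a * b) (sym (^-distribˡ-+-* (+ 2) 4 (3 ℕ.+ e)))
      (∣-trans (*-monoʳ-∣ (+ 16) (odd-power (suc t) e)) (*-monoˡ-∣ b (16∣4^t[2t+2] t)))
      where
      a = (+ 2) ^ (2 ℕ.* suc t) * + (2 ℕ.+ 2 ℕ.* suc t)
      b = (- + suc (2 ℕ.* suc t)) ^ p - 1ℤ

  seriesTerm-periodic : ∀ e n → 6 ℕ.+ e ≤ n → ∀ j →
    (+ 2) ^ (7 ℕ.+ e) ∣ seriesTerm (n ℕ.+ 2 ℕ.^ suc e) j - seriesTerm n j
  seriesTerm-periodic e n 6+e≤n j with even-or-odd j
  ... | t , inj₁ refl = seriesTerm-even t e n
  ... | t , inj₂ refl = ∣m∣n⇒∣m-n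
    (seriesTerm-odd t (ℕ.s≤s (ℕ.≤-trans 6+e≤n (ℕ.m≤m+n n (2 ℕ.^ suc e)))))
    (seriesTerm-odd t (ℕ.s≤s 6+e≤n))

  +2^ : ∀ m → (+ 2) ^ m ≡ + (2 ℕ.^ m)
  +2^ zero    = refl
  +2^ (suc m) = trans (cong (+ 2 *_) (+2^ m)) (sym (pos-* 2 (2 ℕ.^ m)))

  F-periodic : ∀ e n → 6 ℕ.+ e ≤ n → + (2 ℕ.^ (7 ℕ.+ e)) ∣ᵤ + F (n ℕ.+ 2 ℕ.^ suc e) 2 - + F n 2
  F-periodic e n 6+e≤n = ∣⇒∣ᵤ (subst (_∣ + F n′ 2 - + F n 2) (+2^ m) (subst ((+ 2) ^ (7 ℕ.+ e) ∣_)
    (cancel (+ F n′ 2) (+ F n 2) (∑< m (seriesTerm n′)) (∑< m (seriesTerm n)))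
    (∣m∣n⇒∣m-n (∣m∣n⇒∣m-n (F-series m n′) (F-series m n))
      (subst ((+ 2) ^ m ∣_) ∑-difference (∣-∑< m (seriesTerm-periodic e n 6+e≤n))))))
    where
    m = 7 ℕ.+ e
    n′ = n ℕ.+ 2 ℕ.^ suc e
    cancel : ∀ f f′ g g′ → (f + g - (f′ + g′)) - (g + -1ℤ * g′) ≡ f - f′
    cancel = solve-∀
    negate : ∀ a b → a - b ≡ a + -1ℤ * b
    negate = solve-∀
    ∑-difference : ∑< m (λ j → seriesTerm n′ j - seriesTerm n j) ≡ ∑< m (seriesTerm n′) + -1ℤ * ∑< m (seriesTerm n)
    ∑-difference = begin
      ∑< m (λ j → seriesTerm n′ j - seriesTerm n j)
        ≡⟨ ∑<-cong m (λ j → negate (seriesTerm n′ j) (seriesTerm n j)) ⟩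
      ∑< m (λ j → seriesTerm n′ j + -1ℤ * seriesTerm n j)
        ≡⟨ ∑<-+ m (seriesTerm n′) _ ⟩
      ∑< m (seriesTerm n′) + ∑< m (λ j → -1ℤ * seriesTerm n j)
        ≡⟨ cong (λ z → ∑< m (seriesTerm n′) + z) (∑<-*ˡ -1ℤ m (seriesTerm n)) ⟩
      ∑< m (seriesTerm n′) + -1ℤ * ∑< m (seriesTerm n) ∎

open import Data.Nat using (_+_; _^_)
open import Data.Integer using (+_; _-_)
open import Data.Integer.Divisibility using (_∣_)

theorem4p4 : ∀ (m : ℕ) → 7 ≤ m → ∀ (n : ℕ) → m ∸ 1 ≤ n →
    + (2 ^ m) ∣ + F (n + 2 ^ (m ∸ 6)) 2 - + F n 2
theorem4p4 m 7≤m n m∸1≤n with ℕ.m≤n⇒∃[o]m+o≡n 7≤m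
... | e , refl = Series.F-periodic e n m∸1≤n
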